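{- Let $G$ be a connected graph on $n$ vertices. Then $$\overline{S_1}(G)=2(n-1)W(G)-S_1(G)$$ and $$\overline{S_2}(G)=2\,(W(G))^2-\frac12\sum_{u\in V(G)}(\sigma_G(u))^2-S_2(G).$$
   Context: Graphs are finite and simple, with vertex set $V(G)$ and edge set $E(G)$. For a connected graph $G$, $d_G(u,v)$ is the shortest-path distance, the status of a vertex $u$ is $\sigma_G(u)=\sum_{v\in V(G)}d_G(u,v)$, and the Wiener index is $W(G)=\sum_{\{u,v\}\subseteq V(G)}d_G(u,v)=\frac12\sum_{u\in V(G)}\sigma_G(u)$. The status connectivity indices are $S_1(G)=\sum_{uv\in E(G)}[\sigma_G(u)+\sigma_G(v)]$ and $S_2(G)=\sum_{uv\in E(G)}\sigma_G(u)\sigma_G(v)$. The status co-indices are $\overline{S_1}(G)=\sum_{uv\notin E(G)}[\sigma_G(u)+\sigma_G(v)]$ and $\overline{S_2}(G)=\sum_{uv\notin E(G)}\sigma_G(u)\sigma_G(v)$, where the sums over $uv\notin E(G)$ range over unordered pairs of distinct non-adjacent vertices. -}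

module Defs where

open import Data.Fin.Base using (Fin; zero; suc; inject₁; fromℕ)
open import Data.Fin.Properties using (_≟_; _<?_; all?; any?)
open import Data.Integer.Base using (+_)
open import Data.List.Base using (List; map; filter; allFin; cartesianProduct)
open import Data.Nat.Base using (ℕ; zero; suc; _+_; _*_; _≤_; z≤n; s≤s)
open import Data.Nat.ListAction using (sum)
open import Data.Product.Base using (∃; _×_; _,_; proj₁)
open import Data.Rational.Base using (ℚ; _/_)
open import Data.Vec.Base using (Vec; []; _∷_; lookup)
open import Data.Vec.Relation.Unary.AllPairs using (allPairs?)
open import Data.Vec.Relation.Unary.Unique.Propositional using (Unique)
open import Level using (0ℓ)
open import Relation.Binary.Core using (Rel)
open import Relation.Binary.Definitions using (Symmetric; Irreflexive; Decidable)
open import Relation.Binary.PropositionalEquality.Core using (_≡_)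
open import Relation.Nullary.Decidable using (Dec; yes; no; map′; ¬?; _×-dec_)
open import Relation.Nullary.Negation using (contradiction)

-- Adjacency is decidable so that sums over edges and non-edges can be
-- computed; classically this is no restriction.
record Graph (n : ℕ) : Set₁ where
  field
    Adj    : Rel (Fin n) 0ℓ
    adj?   : Decidable Adj
    sym    : Symmetric Adj
    irrefl : Irreflexive _≡_ Adj

-- The sequence xs of k + 1 vertices is a path of length k from u to v.
record IsPath {n} (G : Graph n) (u v : Fin n) (k : ℕ)
              (xs : Vec (Fin n) (suc k)) : Set where
  constructor isPath
  open Graph G
  field
    start    : lookup xs zero ≡ u
    end      : lookup xs (fromℕ k) ≡ v
    adjacent : ∀ (i : Fin k) → Adj (lookup xs (inject₁ i)) (lookup xs (suc i))
    distinct : Unique xs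

HasPath : ∀ {n} → Graph n → Fin n → Fin n → ℕ → Set
HasPath G u v k = ∃ (IsPath G u v k)

Connected : ∀ {n} → Graph n → Set
Connected G = ∀ u v → ∃ (HasPath G u v)

isPath? : ∀ {n} (G : Graph n) u v k xs → Dec (IsPath G u v k xs)
isPath? G u v k xs =
  map′ (λ (s , e , a , d) → isPath s e a d)
       (λ (isPath s e a d) → s , e , a , d)
       (lookup xs zero ≟ u
         ×-dec lookup xs (fromℕ k) ≟ v
         ×-dec all? (λ i → Graph.adj? G (lookup xs (inject₁ i)) (lookup xs (suc i)))
         ×-dec allPairs? (λ x y → ¬? (x ≟ y)) xs)

anyVec? : ∀ {n} k {P : Vec (Fin n) k → Set} → (∀ xs → Dec (P xs)) → Dec (∃ P)
anyVec? zero    P? = map′ ([] ,_) (λ { ([] , p) → p }) (P? [])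
anyVec? (suc k) P? =
  map′ (λ (x , xs , p) → x ∷ xs , p)
       (λ { (x ∷ xs , p) → x , xs , p })
       (any? (λ x → anyVec? k (λ xs → P? (x ∷ xs))))

hasPath? : ∀ {n} (G : Graph n) u v k → Dec (HasPath G u v k)
hasPath? G u v k = anyVec? (suc k) (isPath? G u v k)

Least : (ℕ → Set) → ℕ → Set
Least P k = P k × (∀ j → P j → k ≤ j)

least : ∀ {P : ℕ → Set} → (∀ k → Dec (P k)) → ∃ P → ∃ (Least P)
least P? (m , pm) = go P? m pm
  where
  go : ∀ {Q : ℕ → Set} → (∀ k → Dec (Q k)) → ∀ m → Q m → ∃ (Least Q)
  go Q? m q with Q? zero
  go Q? m       q | yes q₀ = zero , q₀ , λ _ _ → z≤n
  go Q? zero    q | no ¬q₀ = contradiction q ¬q₀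
  go Q? (suc m) q | no ¬q₀ with go (λ k → Q? (suc k)) m q
  ... | k , qk , min = suc k , qk , λ
    { zero    q₀ → contradiction q₀ ¬q₀
    ; (suc j) qj → s≤s (min j qj)
    }

shortest : ∀ {n} (G : Graph n) → Connected G → ∀ u v → ∃ (Least (HasPath G u v))
shortest G conn u v = least (hasPath? G u v) (conn u v)

dist : ∀ {n} (G : Graph n) → Connected G → Fin n → Fin n → ℕ
dist G conn u v = proj₁ (shortest G conn u v)

∑ : {A : Set} → List A → (A → ℕ) → ℕ
∑ xs f = sum (map f xs)

-- An unordered pair {u, v} of distinct vertices is represented once, by the
-- ordered pair with u < v.
pairs : ∀ n → List (Fin n × Fin n)
pairs n = filter (λ (u , v) → u <? v) (cartesianProduct (allFin n) (allFin n))

edges : ∀ {n} → Graph n → List (Fin n × Fin n)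
edges {n} G = filter (λ (u , v) → Graph.adj? G u v) (pairs n)

nonEdges : ∀ {n} → Graph n → List (Fin n × Fin n)
nonEdges {n} G = filter (λ (u , v) → ¬? (Graph.adj? G u v)) (pairs n)

module _ {n} (G : Graph n) (conn : Connected G) where

  σ : Fin n → ℕ
  σ u = ∑ (allFin n) λ v → dist G conn u v

  W : ℕ
  W = ∑ (pairs n) λ (u , v) → dist G conn u v

  S₁ : ℕ
  S₁ = ∑ (edges G) λ (u , v) → σ u + σ v

  S₂ : ℕ
  S₂ = ∑ (edges G) λ (u , v) → σ u * σ v

  coS₁ : ℕ
  coS₁ = ∑ (nonEdges G) λ (u , v) → σ u + σ v

  coS₂ : ℕ
  coS₂ = ∑ (nonEdges G) λ (u , v) → σ u * σ v

-- The identities involve subtraction and the factor ½, so they are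
-- stated in ℚ.
toℚ : ℕ → ℚ
toℚ m = + m / 1

{-# OPTIONS --safe #-}

-- Adding S₁ (resp. S₂) turns the co-index into a sum over all pairs u < v.
-- Since f(u,v) + f(v,u) summed over u < v plus f(u,u) summed over u is the
-- full double sum of f, the cases f = σ u, f = σ u · σ v and f = d(u,v)
-- give nΣσ, (Σσ)² and Σσ = 2W; the last uses d(u,v) = d(v,u) and d(u,u) = 0.
module Submission where

open import Defs
open import Data.Bool.Base using (if_then_else_)
open import Data.Fin.Base using (Fin; zero; suc; inject₁; fromℕ; opposite)
open import Data.Fin.Properties as Fin using (_≟_; _<?_; opposite-involutive)
import Data.Integer.Base as ℤ
import Data.Integer.Properties as ℤ
open import Data.List.Base using (List; []; _∷_; _++_; map; filter; allFin; length; cartesianProduct)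
open import Data.List.Properties using (map-++; map-∘; map-cong; map-tabulate; length-tabulate)
import Data.Nat.Base as ℕ
open import Data.Nat.Base using (ℕ; zero; suc; _^_)
open import Data.Nat.ListAction using (sum)
open import Data.Nat.ListAction.Properties using (sum-++)
import Data.Nat.Properties as ℕ
open import Data.Product.Base using (_×_; _,_; proj₂)
open import Data.Rational.Base using (_+_; _-_; _*_; ½; 1ℚ; toℚᵘ)
open import Data.Rational.Properties
  using (toℚᵘ-injective; toℚᵘ-fromℚᵘ; toℚᵘ-homo-+; toℚᵘ-homo-*)
import Data.Rational.Solver as ℚSolver
import Data.Rational.Unnormalised.Base as ℚᵘ
import Data.Rational.Unnormalised.Properties as ℚᵘ
open import Data.Vec.Base using ([]; _∷_; lookup; tabulate)
open import Data.Vec.Properties using (lookup∘tabulate)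
open import Data.Vec.Relation.Unary.All using ([])
open import Data.Vec.Relation.Unary.AllPairs using ([]; _∷_)
open import Data.Vec.Relation.Unary.Unique.Propositional.Properties
  using (tabulate⁺; lookup-injective)
open import Function.Base using (id; _∘_)
open import Relation.Binary.Definitions using (tri<; tri≈; tri>)
open import Relation.Binary.PropositionalEquality.Core
  using (_≡_; refl; sym; trans; cong; cong₂; subst₂)
open import Relation.Binary.PropositionalEquality.Properties using (module ≡-Reasoning)
open import Relation.Nullary.Decidable
  using (Dec; yes; no; does; ¬?; dec-true; dec-false)
open import Relation.Nullary.Negation using (¬_)
open import Relation.Unary using (Decidable)

-- Finite sums

private variable
  A B : Set

∑-cong : ∀ (xs : List A) {f g : A → ℕ} → (∀ x → f x ≡ g x) → ∑ xs f ≡ ∑ xs g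
∑-cong xs f≗g = cong sum (map-cong f≗g xs)

∑-distrib-+ : ∀ (xs : List A) (f g : A → ℕ) →
              ∑ xs (λ x → f x ℕ.+ g x) ≡ ∑ xs f ℕ.+ ∑ xs g
∑-distrib-+ []       f g = refl
∑-distrib-+ (x ∷ xs) f g = begin
  f x ℕ.+ g x ℕ.+ ∑ xs (λ x → f x ℕ.+ g x)   ≡⟨ cong (f x ℕ.+ g x ℕ.+_) (∑-distrib-+ xs f g) ⟩
  f x ℕ.+ g x ℕ.+ (∑ xs f ℕ.+ ∑ xs g)        ≡⟨ interchange (f x) (g x) _ _ ⟩
  f x ℕ.+ ∑ xs f ℕ.+ (g x ℕ.+ ∑ xs g)        ∎
  where
  open ≡-Reasoning
  open import Algebra.Properties.CommutativeSemigroup ℕ.+-commutativeSemigroup using (interchange)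

∑-*ˡ : ∀ (xs : List A) (f : A → ℕ) c → ∑ xs (λ x → c ℕ.* f x) ≡ c ℕ.* ∑ xs f
∑-*ˡ []       f c = sym (ℕ.*-zeroʳ c)
∑-*ˡ (x ∷ xs) f c = trans (cong (c ℕ.* f x ℕ.+_) (∑-*ˡ xs f c)) (sym (ℕ.*-distribˡ-+ c (f x) _))

∑-*ʳ : ∀ (xs : List A) (f : A → ℕ) c → ∑ xs (λ x → f x ℕ.* c) ≡ ∑ xs f ℕ.* c
∑-*ʳ xs f c = trans (∑-cong xs (λ x → ℕ.*-comm (f x) c)) (trans (∑-*ˡ xs f c) (ℕ.*-comm c _))

∑-const : ∀ (xs : List A) c → ∑ xs (λ _ → c) ≡ length xs ℕ.* c
∑-const []       c = refl
∑-const (x ∷ xs) c = cong (c ℕ.+_) (∑-const xs c)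

∑-comm : ∀ (xs : List A) (ys : List B) (f : A → B → ℕ) →
         ∑ xs (λ x → ∑ ys (f x)) ≡ ∑ ys (λ y → ∑ xs (λ x → f x y))
∑-comm []       ys f = sym (trans (∑-const ys 0) (ℕ.*-zeroʳ (length ys)))
∑-comm (x ∷ xs) ys f =
  trans (cong (∑ ys (f x) ℕ.+_) (∑-comm xs ys f)) (sym (∑-distrib-+ ys (f x) _))

∑-cartesianProduct : ∀ (xs : List A) (ys : List B) (f : A × B → ℕ) →
                     ∑ (cartesianProduct xs ys) f ≡ ∑ xs (λ x → ∑ ys (λ y → f (x , y)))
∑-cartesianProduct []       ys f = refl
∑-cartesianProduct (x ∷ xs) ys f = begin
  ∑ (map (x ,_) ys ++ cartesianProduct xs ys) f
    ≡⟨ cong sum (map-++ f (map (x ,_) ys) _) ⟩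
  sum (map f (map (x ,_) ys) ++ map f (cartesianProduct xs ys))
    ≡⟨ sum-++ (map f (map (x ,_) ys)) _ ⟩
  ∑ (map (x ,_) ys) f ℕ.+ ∑ (cartesianProduct xs ys) f
    ≡⟨ cong₂ ℕ._+_ (cong sum (sym (map-∘ ys))) (∑-cartesianProduct xs ys f) ⟩
  ∑ ys (λ y → f (x , y)) ℕ.+ ∑ xs (λ x → ∑ ys (λ y → f (x , y))) ∎
  where
  open ≡-Reasoning

-- Iverson brackets and filtered sums

infix 8 ⟦_⟧_

-- An Iverson bracket used as a multiplier. It inspects only `does`, so it computes through `map′`
-- whatever the proof component is.
⟦_⟧_ : {P : Set} → Dec P → ℕ → ℕ
⟦ P? ⟧ m = if does P? then m else 0

⟦⟧-true : ∀ {P : Set} (P? : Dec P) → P → ∀ m → ⟦ P? ⟧ m ≡ m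
⟦⟧-true P? p m = cong (if_then m else 0) (dec-true P? p)

⟦⟧-false : ∀ {P : Set} (P? : Dec P) → ¬ P → ∀ m → ⟦ P? ⟧ m ≡ 0
⟦⟧-false P? ¬p m = cong (if_then m else 0) (dec-false P? ¬p)

∑-filter : ∀ {P : A → Set} (P? : Decidable P) xs (f : A → ℕ) →
           ∑ (filter P? xs) f ≡ ∑ xs (λ x → ⟦ P? x ⟧ f x)
∑-filter P? []       f = refl
∑-filter P? (x ∷ xs) f with P? x
... | yes _ = cong (f x ℕ.+_) (∑-filter P? xs f)
... | no  _ = ∑-filter P? xs f

-- With adjacency for `P?` and `pairs n` for `xs`, the two filtered lists are `nonEdges` and
-- `edges`, so this merges a co-index with its index.
∑-filter-∁ : ∀ {P : A → Set} (P? : Decidable P) xs (f : A → ℕ) →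
             ∑ (filter (¬? ∘ P?) xs) f ℕ.+ ∑ (filter P? xs) f ≡ ∑ xs f
∑-filter-∁ P? xs f = begin
  ∑ (filter (¬? ∘ P?) xs) f ℕ.+ ∑ (filter P? xs) f
    ≡⟨ cong₂ ℕ._+_ (∑-filter (¬? ∘ P?) xs f) (∑-filter P? xs f) ⟩
  ∑ xs (λ x → ⟦ ¬? (P? x) ⟧ f x) ℕ.+ ∑ xs (λ x → ⟦ P? x ⟧ f x)
    ≡⟨ ∑-distrib-+ xs _ _ ⟨
  ∑ xs (λ x → ⟦ ¬? (P? x) ⟧ f x ℕ.+ ⟦ P? x ⟧ f x)
    ≡⟨ ∑-cong xs complementary ⟩
  ∑ xs f ∎
  where
  open ≡-Reasoning
  complementary : ∀ x → ⟦ ¬? (P? x) ⟧ f x ℕ.+ ⟦ P? x ⟧ f x ≡ f x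
  complementary x with P? x
  ... | yes _ = refl
  ... | no  _ = ℕ.+-identityʳ (f x)

∑-allFin-suc : ∀ n (f : Fin (suc n) → ℕ) →
               ∑ (allFin (suc n)) f ≡ f zero ℕ.+ ∑ (allFin n) (f ∘ suc)
∑-allFin-suc n f = cong (λ xs → f zero ℕ.+ sum xs)
  -- The tail of `allFin (suc n)` is `tabulate suc`, not a `map` over `allFin n`; both sides meet at
  -- `tabulate (f ∘ suc)`.
  (trans (map-tabulate suc f) (sym (map-tabulate id (f ∘ suc))))

-- The bracket acts as a Kronecker delta; this collapses the diagonal part of a double sum to a
-- single sum.
∑-≟ : ∀ {n} (u : Fin n) (f : Fin n → ℕ) → ∑ (allFin n) (λ v → ⟦ u ≟ v ⟧ f v) ≡ f u
∑-≟ {suc n} zero f = begin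
  ∑ (allFin (suc n)) (λ v → ⟦ zero ≟ v ⟧ f v) ≡⟨ ∑-allFin-suc n _ ⟩
  f zero ℕ.+ ∑ (allFin n) (λ _ → 0)           ≡⟨ cong (f zero ℕ.+_) (∑-const (allFin n) 0) ⟩
  f zero ℕ.+ length (allFin n) ℕ.* 0          ≡⟨ cong (f zero ℕ.+_) (ℕ.*-zeroʳ (length (allFin n))) ⟩
  f zero ℕ.+ 0                                ≡⟨ ℕ.+-identityʳ (f zero) ⟩
  f zero                                      ∎
  where open ≡-Reasoning
∑-≟ {suc n} (suc u) f =
  -- The head term reduces to `0`, and `does (suc u ≟ suc v)` reduces to `does (u ≟ v)`, so the tail
  -- is literally the induction hypothesis.
  trans (∑-allFin-suc n (λ v → ⟦ suc u ≟ v ⟧ f v)) (∑-≟ u (f ∘ suc))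

-- Double sums and sums over unordered pairs

∑-pairs : ∀ {n} (f : Fin n × Fin n → ℕ) →
          ∑ (pairs n) f ≡ ∑ (allFin n) (λ u → ∑ (allFin n) (λ v → ⟦ u <? v ⟧ f (u , v)))
∑-pairs {n} f =
  trans (∑-filter (λ (u , v) → u <? v) (cartesianProduct (allFin n) (allFin n)) f)
        (∑-cartesianProduct (allFin n) (allFin n) _)

-- Exactly one of the three brackets is active. Summed over all `u` and `v`, this cuts the square
-- into upper triangle, lower triangle and diagonal.
trichotomy : ∀ {n} (u v : Fin n) m →
             m ≡ ⟦ u <? v ⟧ m ℕ.+ ⟦ v <? u ⟧ m ℕ.+ ⟦ u ≟ v ⟧ m
trichotomy u v m with Fin.<-cmp u v
... | tri< u<v u≢v v≮u
  rewrite ⟦⟧-true (u <? v) u<v m | ⟦⟧-false (v <? u) v≮u m | ⟦⟧-false (u ≟ v) u≢v m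
  = sym (trans (ℕ.+-identityʳ _) (ℕ.+-identityʳ m))
... | tri≈ u≮v u≡v v≮u
  rewrite ⟦⟧-false (u <? v) u≮v m | ⟦⟧-false (v <? u) v≮u m | ⟦⟧-true (u ≟ v) u≡v m
  = refl
... | tri> u≮v u≢v v<u
  rewrite ⟦⟧-false (u <? v) u≮v m | ⟦⟧-true (v <? u) v<u m | ⟦⟧-false (u ≟ v) u≢v m
  = sym (ℕ.+-identityʳ m)

-- Both orders of each pair appear because `f` may be asymmetric; the first index uses it with a
-- summand that depends on `u` alone.
∑∑-pairs : ∀ {n} (f : Fin n → Fin n → ℕ) →
           ∑ (allFin n) (λ u → ∑ (allFin n) (f u)) ≡
           ∑ (pairs n) (λ (u , v) → f u v ℕ.+ f v u) ℕ.+ ∑ (allFin n) (λ u → f u u)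
∑∑-pairs {n} f = begin
  ∑∑ f
    ≡⟨ ∑∑-cong (λ u v → trichotomy u v (f u v)) ⟩
  ∑∑ (λ u v → ⟦ u <? v ⟧ f u v ℕ.+ ⟦ v <? u ⟧ f u v ℕ.+ ⟦ u ≟ v ⟧ f u v)
    ≡⟨ ∑∑-distrib-+ _ _ ⟩
  ∑∑ (λ u v → ⟦ u <? v ⟧ f u v ℕ.+ ⟦ v <? u ⟧ f u v) ℕ.+ ∑∑ (λ u v → ⟦ u ≟ v ⟧ f u v)
    ≡⟨ cong₂ ℕ._+_ (∑∑-distrib-+ _ _) (∑-cong (allFin n) (λ u → ∑-≟ u (f u))) ⟩
  ∑∑ (λ u v → ⟦ u <? v ⟧ f u v) ℕ.+ ∑∑ (λ u v → ⟦ v <? u ⟧ f u v) ℕ.+ diagonal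
    -- Exchanging the two summations renames the indices: the lower triangle becomes the upper one,
    -- with the arguments of `f` swapped.
    ≡⟨ cong (λ s → ∑∑ (λ u v → ⟦ u <? v ⟧ f u v) ℕ.+ s ℕ.+ diagonal)
            (∑-comm (allFin n) (allFin n) (λ u v → ⟦ v <? u ⟧ f u v)) ⟩
  ∑∑ (λ u v → ⟦ u <? v ⟧ f u v) ℕ.+ ∑∑ (λ u v → ⟦ u <? v ⟧ f v u) ℕ.+ diagonal
    ≡⟨ cong (ℕ._+ diagonal) (cong₂ ℕ._+_ (∑-pairs (λ (u , v) → f u v)) (∑-pairs (λ (u , v) → f v u))) ⟨
  ∑ (pairs n) (λ (u , v) → f u v) ℕ.+ ∑ (pairs n) (λ (u , v) → f v u) ℕ.+ diagonal
    ≡⟨ cong (ℕ._+ diagonal) (∑-distrib-+ (pairs n) _ _) ⟨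
  ∑ (pairs n) (λ (u , v) → f u v ℕ.+ f v u) ℕ.+ diagonal ∎
  where
  open ≡-Reasoning
  diagonal = ∑ (allFin n) (λ u → f u u)

  ∑∑ : (Fin n → Fin n → ℕ) → ℕ
  ∑∑ g = ∑ (allFin n) (λ u → ∑ (allFin n) (g u))

  ∑∑-cong : ∀ {g h : Fin n → Fin n → ℕ} → (∀ u v → g u v ≡ h u v) → ∑∑ g ≡ ∑∑ h
  ∑∑-cong eq = ∑-cong (allFin n) (λ u → ∑-cong (allFin n) (eq u))

  ∑∑-distrib-+ : ∀ (g h : Fin n → Fin n → ℕ) →
                 ∑∑ (λ u v → g u v ℕ.+ h u v) ≡ ∑∑ g ℕ.+ ∑∑ h
  ∑∑-distrib-+ g h = trans (∑-cong (allFin n) (λ u → ∑-distrib-+ (allFin n) (g u) (h u)))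
                           (∑-distrib-+ (allFin n) _ _)

-- Distances

opposite-injective : ∀ {n} {i j : Fin n} → opposite i ≡ opposite j → i ≡ j
opposite-injective {i = i} {j} eq =
  trans (sym (opposite-involutive i)) (trans (cong opposite eq) (opposite-involutive j))

-- `opposite (suc j)` reduces to `inject₁ (opposite j)`; take `opposite i` for `j` and use that
-- `opposite` is an involution.
opposite-inject₁ : ∀ {n} (i : Fin n) → opposite (inject₁ i) ≡ suc (opposite i)
opposite-inject₁ i = begin
  opposite (inject₁ i)                       ≡⟨ cong (opposite ∘ inject₁) (opposite-involutive i) ⟨
  opposite (opposite (suc (opposite i)))     ≡⟨ opposite-involutive (suc (opposite i)) ⟩
  suc (opposite i)                           ∎
  where open ≡-Reasoning

-- The path is read backwards, by indexing it through `opposite`.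
HasPath-sym : ∀ {n} (G : Graph n) {u v k} → HasPath G u v k → HasPath G v u k
HasPath-sym G {u} {v} {k} (xs , isPath start end adjacent distinct) =
  tabulate ys , isPath
    -- The first vertex of the reversal computes to `lookup xs (fromℕ k)`, since `opposite zero` is
    -- `fromℕ k`.
    end
    (trans (lookup∘tabulate ys (fromℕ k))
           (trans (cong (lookup xs) (opposite-involutive zero)) start))
    -- Edge `i` of the reversal is edge `opposite i` of the original, traversed the other way.
    (λ i → subst₂ (Graph.Adj G)
      (sym (trans (lookup∘tabulate ys (inject₁ i)) (cong (lookup xs) (opposite-inject₁ i))))
      (sym (lookup∘tabulate ys (suc i)))
      (Graph.sym G (adjacent (opposite i))))
    (tabulate⁺ (λ eq → opposite-injective (lookup-injective distinct _ _ eq)))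
  where
  ys = lookup xs ∘ opposite

HasPath-refl : ∀ {n} (G : Graph n) u → HasPath G u u 0
HasPath-refl G u = u ∷ [] , isPath refl refl (λ ()) ([] ∷ [])

module _ {n} (G : Graph n) (conn : Connected G) where

  private
    d = dist G conn

  dist-minimal : ∀ {u v k} → HasPath G u v k → d u v ℕ.≤ k
  dist-minimal {u} {v} {k} = proj₂ (proj₂ (shortest G conn u v)) k

  dist-attained : ∀ u v → HasPath G u v (d u v)
  dist-attained u v with shortest G conn u v
  ... | _ , path , _ = path

  -- Reversal preserves length, so a shortest path in either direction bounds the distance in the
  -- other.
  dist-sym : ∀ u v → d u v ≡ d v u
  dist-sym u v = ℕ.≤-antisym
    (dist-minimal (HasPath-sym G (dist-attained v u)))
    (dist-minimal (HasPath-sym G (dist-attained u v)))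

  dist-refl : ∀ u → d u u ≡ 0
  dist-refl u = ℕ.n≤0⇒n≡0 (dist-minimal (HasPath-refl G u))

  -- The identities over ℕ

  ∑σ≡2W : ∑ (allFin n) (σ G conn) ≡ 2 ℕ.* W G conn
  ∑σ≡2W = begin
    ∑ (allFin n) (σ G conn)
      ≡⟨ ∑∑-pairs d ⟩
    ∑ (pairs n) (λ (u , v) → d u v ℕ.+ d v u) ℕ.+ ∑ (allFin n) (λ u → d u u)
      ≡⟨ cong₂ ℕ._+_
           (∑-cong (pairs n) (λ (u , v) →
             -- `2 * m` unfolds to `m + (m + 0)`, which accounts for the trailing zero.
             cong (d u v ℕ.+_) (trans (dist-sym v u) (sym (ℕ.+-identityʳ _)))))
           (trans (∑-cong (allFin n) dist-refl)
                  (trans (∑-const (allFin n) 0) (ℕ.*-zeroʳ (length (allFin n))))) ⟩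
    ∑ (pairs n) (λ (u , v) → 2 ℕ.* d u v) ℕ.+ 0
      ≡⟨ ℕ.+-identityʳ _ ⟩
    ∑ (pairs n) (λ (u , v) → 2 ℕ.* d u v)
      ≡⟨ ∑-*ˡ (pairs n) _ 2 ⟩
    2 ℕ.* W G conn ∎
    where open ≡-Reasoning

  -- A form free of subtraction. The summand `2 * W` is the diagonal contribution of `σ u`; moving
  -- it across later turns the factor `n` into `n - 1`.
  coS₁+S₁+2W : coS₁ G conn ℕ.+ S₁ G conn ℕ.+ 2 ℕ.* W G conn ≡ n ℕ.* (2 ℕ.* W G conn)
  coS₁+S₁+2W = begin
    coS₁ G conn ℕ.+ S₁ G conn ℕ.+ 2 ℕ.* W G conn
      ≡⟨ cong₂ ℕ._+_ (∑-filter-∁ (λ (u , v) → Graph.adj? G u v) (pairs n) _) (sym ∑σ≡2W) ⟩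
    ∑ (pairs n) (λ (u , v) → σ G conn u ℕ.+ σ G conn v) ℕ.+ ∑ (allFin n) (σ G conn)
      ≡⟨ ∑∑-pairs (λ u _ → σ G conn u) ⟨
    ∑ (allFin n) (λ u → ∑ (allFin n) (λ _ → σ G conn u))
      ≡⟨ ∑-comm (allFin n) (allFin n) (λ u _ → σ G conn u) ⟩
    ∑ (allFin n) (λ _ → ∑ (allFin n) (σ G conn))
      ≡⟨ ∑-const (allFin n) _ ⟩
    length (allFin n) ℕ.* ∑ (allFin n) (σ G conn)
      ≡⟨ cong₂ ℕ._*_ (length-tabulate {n = n} id) ∑σ≡2W ⟩
    n ℕ.* (2 ℕ.* W G conn) ∎
    where open ≡-Reasoning

  -- The double sum of `σ u * σ v` factors as the square of the total status. Symmetry makes each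
  -- pair count twice, and keeping that factor 2 avoids the ½.
  2[coS₂+S₂]+∑σ² :
    2 ℕ.* (coS₂ G conn ℕ.+ S₂ G conn) ℕ.+ ∑ (allFin n) (λ u → σ G conn u ^ 2) ≡
    2 ℕ.* W G conn ℕ.* (2 ℕ.* W G conn)
  2[coS₂+S₂]+∑σ² = begin
    2 ℕ.* (coS₂ G conn ℕ.+ S₂ G conn) ℕ.+ ∑ (allFin n) (λ u → s u ^ 2)
      ≡⟨ cong₂ ℕ._+_
           (cong (2 ℕ.*_) (∑-filter-∁ (λ (u , v) → Graph.adj? G u v) (pairs n) _))
           -- `s u ^ 2` unfolds to `s u * (s u * 1)`.
           (∑-cong (allFin n) (λ u → cong (s u ℕ.*_) (ℕ.*-identityʳ (s u)))) ⟩
    2 ℕ.* ∑ (pairs n) (λ (u , v) → s u ℕ.* s v) ℕ.+ ∑ (allFin n) (λ u → s u ℕ.* s u)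
      ≡⟨ cong (ℕ._+ ∑σ²) (∑-*ˡ (pairs n) _ 2) ⟨
    ∑ (pairs n) (λ (u , v) → 2 ℕ.* (s u ℕ.* s v)) ℕ.+ ∑ (allFin n) (λ u → s u ℕ.* s u)
      ≡⟨ cong (ℕ._+ ∑σ²) (∑-cong (pairs n) (λ (u , v) →
           cong (s u ℕ.* s v ℕ.+_) (trans (ℕ.+-identityʳ _) (ℕ.*-comm (s u) (s v))))) ⟩
    ∑ (pairs n) (λ (u , v) → s u ℕ.* s v ℕ.+ s v ℕ.* s u) ℕ.+ ∑ (allFin n) (λ u → s u ℕ.* s u)
      ≡⟨ ∑∑-pairs (λ u v → s u ℕ.* s v) ⟨
    ∑ (allFin n) (λ u → ∑ (allFin n) (λ v → s u ℕ.* s v))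
      ≡⟨ ∑-cong (allFin n) (λ u → ∑-*ˡ (allFin n) s (s u)) ⟩
    ∑ (allFin n) (λ u → s u ℕ.* ∑ (allFin n) s)
      ≡⟨ ∑-*ʳ (allFin n) s _ ⟩
    ∑ (allFin n) s ℕ.* ∑ (allFin n) s
      ≡⟨ cong₂ ℕ._*_ ∑σ≡2W ∑σ≡2W ⟩
    2 ℕ.* W G conn ℕ.* (2 ℕ.* W G conn) ∎
    where
    open ≡-Reasoning
    s = σ G conn
    ∑σ² = ∑ (allFin n) (λ u → s u ℕ.* s u)

-- Passage to ℚ

-- The fraction in `toℚ m` is normalised by a gcd, which does not compute for a variable `m`, so
-- arithmetic is done on unnormalised rationals. The `0` is the denominator minus one.
toℚᵘ-toℚ : ∀ m → toℚᵘ (toℚ m) ℚᵘ.≃ ℚᵘ.mkℚᵘ (ℤ.+ m) 0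
toℚᵘ-toℚ m = toℚᵘ-fromℚᵘ (ℚᵘ.mkℚᵘ (ℤ.+ m) 0)

toℚ-homo-+ : ∀ m n → toℚ (m ℕ.+ n) ≡ toℚ m + toℚ n
toℚ-homo-+ m n = toℚᵘ-injective (begin
  toℚᵘ (toℚ (m ℕ.+ n))                               ≈⟨ toℚᵘ-toℚ (m ℕ.+ n) ⟩
  -- Unnormalised addition cross-multiplies, leaving each numerator multiplied by a denominator 1.
  ℚᵘ.mkℚᵘ (ℤ.+ (m ℕ.+ n)) 0                          ≈⟨ ℚᵘ.≃-reflexive (cong (λ i → ℚᵘ.mkℚᵘ i 0)
                                                          (cong₂ ℤ._+_ (ℤ.*-identityʳ (ℤ.+ m)) (ℤ.*-identityʳ (ℤ.+ n)))) ⟨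
  ℚᵘ.mkℚᵘ (ℤ.+ m) 0 ℚᵘ.+ ℚᵘ.mkℚᵘ (ℤ.+ n) 0           ≈⟨ ℚᵘ.+-cong (toℚᵘ-toℚ m) (toℚᵘ-toℚ n) ⟨
  toℚᵘ (toℚ m) ℚᵘ.+ toℚᵘ (toℚ n)                     ≈⟨ toℚᵘ-homo-+ (toℚ m) (toℚ n) ⟨
  toℚᵘ (toℚ m + toℚ n)                               ∎)
  where open import Relation.Binary.Reasoning.Setoid ℚᵘ.≃-setoid

toℚ-homo-* : ∀ m n → toℚ (m ℕ.* n) ≡ toℚ m * toℚ n
toℚ-homo-* m n = toℚᵘ-injective (begin
  toℚᵘ (toℚ (m ℕ.* n))                               ≈⟨ toℚᵘ-toℚ (m ℕ.* n) ⟩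
  ℚᵘ.mkℚᵘ (ℤ.+ (m ℕ.* n)) 0                          ≈⟨ ℚᵘ.≃-reflexive (cong (λ i → ℚᵘ.mkℚᵘ i 0) (ℤ.pos-* m n)) ⟩
  ℚᵘ.mkℚᵘ (ℤ.+ m) 0 ℚᵘ.* ℚᵘ.mkℚᵘ (ℤ.+ n) 0           ≈⟨ ℚᵘ.*-cong (toℚᵘ-toℚ m) (toℚᵘ-toℚ n) ⟨
  toℚᵘ (toℚ m) ℚᵘ.* toℚᵘ (toℚ n)                     ≈⟨ toℚᵘ-homo-* (toℚ m) (toℚ n) ⟨
  toℚᵘ (toℚ m * toℚ n)                               ∎)
  where open import Relation.Binary.Reasoning.Setoid ℚᵘ.≃-setoid

-- Solving for the co-indices in ℚ

module _ where
  open ≡-Reasoning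
  open ℚSolver.+-*-Solver

  solve-coS₁ : ∀ c s n w → c ℕ.+ s ℕ.+ 2 ℕ.* w ≡ n ℕ.* (2 ℕ.* w) →
               toℚ c ≡ toℚ 2 * (toℚ n - 1ℚ) * toℚ w - toℚ s
  solve-coS₁ c s n w eq = begin
    toℚ c
      -- Adding and subtracting `s` and `2 * w` exposes the left side of `eqℚ`.
      ≡⟨ solve 3 (λ c s w → c := c :+ s :+ con (toℚ 2) :* w :- s :- con (toℚ 2) :* w)
               refl (toℚ c) (toℚ s) (toℚ w) ⟩
    toℚ c + toℚ s + toℚ 2 * toℚ w - toℚ s - toℚ 2 * toℚ w
      ≡⟨ cong (λ x → x - toℚ s - toℚ 2 * toℚ w) eqℚ ⟩
    toℚ n * (toℚ 2 * toℚ w) - toℚ s - toℚ 2 * toℚ w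
      ≡⟨ solve 3 (λ n s w → n :* (con (toℚ 2) :* w) :- s :- con (toℚ 2) :* w
                         := con (toℚ 2) :* (n :- con 1ℚ) :* w :- s)
               refl (toℚ n) (toℚ s) (toℚ w) ⟩
    toℚ 2 * (toℚ n - 1ℚ) * toℚ w - toℚ s ∎
    where
    eqℚ : toℚ c + toℚ s + toℚ 2 * toℚ w ≡ toℚ n * (toℚ 2 * toℚ w)
    eqℚ = begin
      toℚ c + toℚ s + toℚ 2 * toℚ w     ≡⟨ cong₂ _+_ (toℚ-homo-+ c s) (toℚ-homo-* 2 w) ⟨
      toℚ (c ℕ.+ s) + toℚ (2 ℕ.* w)     ≡⟨ toℚ-homo-+ (c ℕ.+ s) (2 ℕ.* w) ⟨
      toℚ (c ℕ.+ s ℕ.+ 2 ℕ.* w)         ≡⟨ cong toℚ eq ⟩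
      toℚ (n ℕ.* (2 ℕ.* w))             ≡⟨ toℚ-homo-* n (2 ℕ.* w) ⟩
      toℚ n * toℚ (2 ℕ.* w)             ≡⟨ cong (toℚ n *_) (toℚ-homo-* 2 w) ⟩
      toℚ n * (toℚ 2 * toℚ w)           ∎

  solve-coS₂ : ∀ c s q w → 2 ℕ.* (c ℕ.+ s) ℕ.+ q ≡ 2 ℕ.* w ℕ.* (2 ℕ.* w) →
               toℚ c ≡ toℚ 2 * (toℚ w * toℚ w) - ½ * toℚ q - toℚ s
  solve-coS₂ c s q w eq = begin
    toℚ c
      -- Halving undoes the doubling of `c + s`; the terms in `q` and `s` cancel, and the left side
      -- of `eqℚ` appears under the ½.
      ≡⟨ solve 3 (λ c s q → c := con ½ :* (con (toℚ 2) :* (c :+ s) :+ q) :- con ½ :* q :- s)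
               refl (toℚ c) (toℚ s) (toℚ q) ⟩
    ½ * (toℚ 2 * (toℚ c + toℚ s) + toℚ q) - ½ * toℚ q - toℚ s
      ≡⟨ cong (λ x → ½ * x - ½ * toℚ q - toℚ s) eqℚ ⟩
    ½ * (toℚ 2 * toℚ w * (toℚ 2 * toℚ w)) - ½ * toℚ q - toℚ s
      ≡⟨ solve 3 (λ s q w → con ½ :* (con (toℚ 2) :* w :* (con (toℚ 2) :* w)) :- con ½ :* q :- s
                         := con (toℚ 2) :* (w :* w) :- con ½ :* q :- s)
               refl (toℚ s) (toℚ q) (toℚ w) ⟩
    toℚ 2 * (toℚ w * toℚ w) - ½ * toℚ q - toℚ s ∎
    where
    eqℚ : toℚ 2 * (toℚ c + toℚ s) + toℚ q ≡ toℚ 2 * toℚ w * (toℚ 2 * toℚ w)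
    eqℚ = begin
      toℚ 2 * (toℚ c + toℚ s) + toℚ q     ≡⟨ cong (λ x → toℚ 2 * x + toℚ q) (toℚ-homo-+ c s) ⟨
      toℚ 2 * toℚ (c ℕ.+ s) + toℚ q       ≡⟨ cong (_+ toℚ q) (toℚ-homo-* 2 (c ℕ.+ s)) ⟨
      toℚ (2 ℕ.* (c ℕ.+ s)) + toℚ q       ≡⟨ toℚ-homo-+ (2 ℕ.* (c ℕ.+ s)) q ⟨
      toℚ (2 ℕ.* (c ℕ.+ s) ℕ.+ q)         ≡⟨ cong toℚ eq ⟩
      toℚ (2 ℕ.* w ℕ.* (2 ℕ.* w))         ≡⟨ toℚ-homo-* (2 ℕ.* w) (2 ℕ.* w) ⟩
      toℚ (2 ℕ.* w) * toℚ (2 ℕ.* w)       ≡⟨ cong₂ _*_ (toℚ-homo-* 2 w) (toℚ-homo-* 2 w) ⟩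
      toℚ 2 * toℚ w * (toℚ 2 * toℚ w)     ∎

proposition2p1 : ∀ (n : ℕ) (G : Graph n) (conn : Connected G) →
    (toℚ (coS₁ G conn) ≡ toℚ 2 * (toℚ n - 1ℚ) * toℚ (W G conn) - toℚ (S₁ G conn))
    × (toℚ (coS₂ G conn) ≡
    toℚ 2 * (toℚ (W G conn) * toℚ (W G conn))
    - ½ * toℚ (∑ (allFin n) (λ u → σ G conn u ^ 2))
    - toℚ (S₂ G conn))
proposition2p1 n G conn =
    solve-coS₁ (coS₁ G conn) (S₁ G conn) n (W G conn) (coS₁+S₁+2W G conn)
  , solve-coS₂ (coS₂ G conn) (S₂ G conn) _ (W G conn) (2[coS₂+S₂]+∑σ² G conn)
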